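{- For every graph $G$ and every integer $m\ge 1$, the super subdivision of $G$ (obtained by replacing every edge of $G$ by a complete bipartite graph $K_{2,m}$) admits a uniform WIASI.
   Context: All graphs are finite, simple and without isolated vertices. $\mathbb{N}_0$ denotes the set of non-negative integers; for finite $A,B\subseteq\mathbb{N}_0$, $A+B=\{a+b: a\in A, b\in B\}$. An integer additive set-indexer (IASI) of a graph $G$ is an injective map $f$ from $V(G)$ to the finite non-empty subsets of $\mathbb{N}_0$ such that the induced edge map $f^+(uv)=f(u)+f(v)$ is injective on $E(G)$. A weak IASI (WIASI) is an IASI $f$ with $|f^+(uv)|=\max(|f(u)|,|f(v)|)$ for every edge $uv$. For an integer $k\ge 2$, a WIASI $f$ is $k$-uniform if $|f^+(e)|=k$ for every edge $e$; $G$ admits a uniform WIASI (UWIASI) if it admits a $k$-uniform WIASI for some integer $k\ge 2$. In the super subdivision, each edge $uv$ of $G$ is replaced by $m$ new vertices $x_1,\dots,x_m$, each adjacent to both $u$ and $v$ (the edge $uv$ itself being removed), so that $u,v$ form the part of size $2$ of a $K_{2,m}$. -}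

module Defs where

open import Data.Empty using (⊥)
open import Data.Fin.Base as Fin using (Fin; zero; suc; fromℕ<)
open import Data.Fin.Properties as Fin using (+↔⊎; *↔×; <-cmp)
open import Data.Irrelevant using ([_])
open import Data.List.Base using (length; deduplicate)
open import Data.List.NonEmpty as List⁺ using (List⁺; toList)
open import Data.List.Relation.Binary.BagAndSetEquality using (_∼[_]_; set)
open import Data.Nat.Base using (ℕ; zero; suc; _+_; _*_; _⊔_; _≤_; NonZero; >-nonZero⁻¹)
import Data.Nat.Properties as ℕ
open import Data.Product.Base using (∃; _×_; _,_; proj₁; proj₂)
open import Data.Product.Function.NonDependent.Propositional using (_×-↔_)
open import Data.Refinement using (Refinement; value; value-injective; _,_)
open import Data.Sum.Base using (_⊎_; inj₁; inj₂)
open import Data.Sum.Function.Propositional using (_⊎-↔_)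
open import Function.Base using (_∘_)
open import Function.Bundles using (_↔_; Inverse; mk↔ₛ′)
open import Function.Construct.Composition using (_↔-∘_)
open import Function.Construct.Identity using (↔-id)
open import Function.Construct.Symmetry using (↔-sym)
open import Function.Definitions using (Injective)
open import Level using (0ℓ)
open import Relation.Binary.Core using (Rel)
open import Relation.Binary.Definitions as B using (DecidableEquality; Irreflexive; Symmetric; tri<; tri≈; tri>)
open import Relation.Binary.PropositionalEquality
  using (_≡_; refl; sym; trans; cong; subst)
open import Relation.Nullary.Decidable using (yes; no; map′; recompute; _×-dec_; _⊎-dec_)
open import Relation.Nullary.Negation using (contradiction)
open import Relation.Unary using (Pred; Decidable)

Finite : Set → Set
Finite A = ∃ λ n → A ↔ Fin n

private
  finite-refinement-Fin : ∀ n {P : Pred (Fin n) 0ℓ} → Decidable P → Finite (Refinement (Fin n) P)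
  finite-refinement-Fin zero P? = 0 , mk↔ₛ′ value (λ ()) (λ ()) (λ { (() , _) })
  finite-refinement-Fin (suc n) {P} P? with finite-refinement-Fin n (λ i → P? (suc i)) | P? zero
  ... | k , φ | yes p = suc k , mk↔ₛ′ to from to∘from from∘to
    where
    module φ = Inverse φ
    to : Refinement (Fin (suc n)) P → Fin (suc k)
    to (zero  , _) = zero
    to (suc i , q) = suc (φ.to (i , q))
    from : Fin (suc k) → Refinement (Fin (suc n)) P
    from zero    = zero , [ p ]
    from (suc j) with i , q ← φ.from j = suc i , q
    to∘from : ∀ j → to (from j) ≡ j
    to∘from zero    = refl
    to∘from (suc j) = cong suc (φ.strictlyInverseˡ j)
    from∘to : ∀ x → from (to x) ≡ x
    from∘to (zero  , _) = refl
    from∘to (suc i , q) = value-injective (cong (suc ∘ value) (φ.strictlyInverseʳ (i , q)))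
  ... | k , φ | no ¬p = k , mk↔ₛ′ to from to∘from from∘to
    where
    module φ = Inverse φ
    to : Refinement (Fin (suc n)) P → Fin k
    to (zero  , [ p ]) = contradiction (recompute (no ¬p) p) ¬p
    to (suc i , q) = φ.to (i , q)
    from : Fin k → Refinement (Fin (suc n)) P
    from j with i , q ← φ.from j = suc i , q
    to∘from : ∀ j → to (from j) ≡ j
    to∘from j = φ.strictlyInverseˡ j
    from∘to : ∀ x → from (to x) ≡ x
    from∘to (zero  , [ p ]) = contradiction (recompute (no ¬p) p) ¬p
    from∘to (suc i , q) = value-injective (cong (suc ∘ value) (φ.strictlyInverseʳ (i , q)))

  finite-refinement : ∀ {A} {P : Pred A 0ℓ} → Finite A → Decidable P → Finite (Refinement A P)
  finite-refinement {A} {P} (n , φ) P? =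
    let k , ψ = finite-refinement-Fin n (λ i → P? (φ.from i)) in k , (ψ ↔-∘ restrict)
    where
    module φ = Inverse φ
    restrict : Refinement A P ↔ Refinement (Fin n) (P ∘ φ.from)
    restrict = mk↔ₛ′
      (λ { (a , [ p ]) → φ.to a , [ subst P (sym (φ.strictlyInverseʳ a)) p ] })
      (λ { (i , [ p ]) → φ.from i , [ p ] })
      (λ { (i , _) → value-injective (φ.strictlyInverseˡ i) })
      (λ { (a , _) → value-injective (φ.strictlyInverseʳ a) })

  finite-⊎ : ∀ {A B} → Finite A → Finite B → Finite (A ⊎ B)
  finite-⊎ (m , φ) (n , ψ) = m + n , (↔-sym +↔⊎ ↔-∘ (φ ⊎-↔ ψ))

  finite-× : ∀ {A B} → Finite A → Finite B → Finite (A × B)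
  finite-× (m , φ) (n , ψ) = m * n , (↔-sym *↔× ↔-∘ (φ ×-↔ ψ))

record Graph : Set₁ where
  infix 4 _~_ _~?_ _≟_
  field
    V          : Set
    finite     : Finite V
    _~_        : Rel V 0ℓ
    _~?_       : B.Decidable _~_
    ~-irrefl   : Irreflexive _≡_ _~_
    ~-sym      : Symmetric _~_
    noIsolated : ∀ u → ∃ λ v → u ~ v

  index : V → Fin (proj₁ finite)
  index = Inverse.to (proj₂ finite)

  index-injective : Injective _≡_ _≡_ index
  index-injective {u} {v} eq =
    trans (sym (strictlyInverseʳ u)) (trans (cong from eq) (strictlyInverseʳ v))
    where open Inverse (proj₂ finite)

  _≟_ : DecidableEquality V
  u ≟ v = map′ index-injective (cong index) (index u Fin.≟ index v)

  IsEdge : Pred (V × V) 0ℓ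
  IsEdge (u , v) = index u Fin.< index v × u ~ v

  -- The edge set: an unordered pair {u , v} of adjacent vertices is represented
  -- once, by listing its endpoints in the order of the enumeration of V.
  -- The proof component is irrelevant, so edges with equal endpoints are equal.
  Edge : Set
  Edge = Refinement (V × V) IsEdge

  end₁ end₂ : Edge → V
  end₁ e = proj₁ (value e)
  end₂ e = proj₂ (value e)

  finiteEdge : Finite Edge
  finiteEdge = finite-refinement (finite-× finite finite)
    (λ (u , v) → (index u Fin.<? index v) ×-dec (u ~? v))

  _∈ₑ_ : V → Edge → Set
  u ∈ₑ e = u ≡ end₁ e ⊎ u ≡ end₂ e

  _∈ₑ?_ : B.Decidable _∈ₑ_
  u ∈ₑ? e = (u ≟ end₁ e) ⊎-dec (u ≟ end₂ e)

  incidentEdge : ∀ u → ∃ λ e → u ∈ₑ e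
  incidentEdge u with v , u~v ← noIsolated u with <-cmp (index u) (index v)
  ... | tri< u<v _ _ = ((u , v) , [ u<v , u~v ]) , inj₁ refl
  ... | tri≈ _ u≡v _ = contradiction u~v (~-irrefl (index-injective u≡v))
  ... | tri> _ _ v<u = ((v , u) , [ v<u , ~-sym u~v ]) , inj₂ refl

-- The vertex inj₂ (e , i) is the new vertex xᵢ of the copy of K₂,ₘ replacing e.
module _ (G : Graph) (m : ℕ) where
  open Graph G

  SubdivisionVertex : Set
  SubdivisionVertex = V ⊎ (Edge × Fin m)

  SubdivisionAdjacent : Rel SubdivisionVertex 0ℓ
  SubdivisionAdjacent (inj₁ u)       (inj₁ v)       = ⊥
  SubdivisionAdjacent (inj₁ u)       (inj₂ (e , i)) = u ∈ₑ e
  SubdivisionAdjacent (inj₂ (e , i)) (inj₁ u)       = u ∈ₑ e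
  SubdivisionAdjacent (inj₂ _)       (inj₂ _)       = ⊥

superSubdivision : (G : Graph) (m : ℕ) .{{_ : NonZero m}} → Graph
superSubdivision G m = record
  { V          = SubdivisionVertex G m
  ; finite     = finite-⊎ finite (finite-× finiteEdge (m , ↔-id (Fin m)))
  ; _~_        = SubdivisionAdjacent G m
  ; _~?_       = λ
    { (inj₁ _)       (inj₁ _)       → no λ ()
    ; (inj₁ u)       (inj₂ (e , _)) → u ∈ₑ? e
    ; (inj₂ (e , _)) (inj₁ u)       → u ∈ₑ? e
    ; (inj₂ _)       (inj₂ _)       → no λ ()
    }
  ; ~-irrefl   = λ { {inj₁ _} refl () ; {inj₂ _} refl () }
  ; ~-sym      = λ
    { {inj₁ _} {inj₂ _} u∈e → u∈e
    ; {inj₂ _} {inj₁ _} u∈e → u∈e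
    }
  ; noIsolated = λ
    { (inj₁ u)       → let e , u∈e = incidentEdge u
                       in inj₂ (e , fromℕ< (>-nonZero⁻¹ m)) , u∈e
    ; (inj₂ (e , _)) → inj₁ (end₁ e) , inj₁ refl
    }
  }
  where open Graph G

-- A finite non-empty set of non-negative integers is given by a non-empty list
-- of its elements; order and multiplicity are discarded by _≈_ and ∣_∣.
FinSet : Set
FinSet = List⁺ ℕ

infix 4 _≈_
_≈_ : Rel FinSet 0ℓ
A ≈ B = toList A ∼[ set ] toList B

∣_∣ : FinSet → ℕ
∣ A ∣ = length (deduplicate ℕ._≟_ (toList A))

infixl 6 _⊕_
_⊕_ : FinSet → FinSet → FinSet
A ⊕ B = List⁺.concatMap (λ a → List⁺.map (a +_) B) A

module _ (G : Graph) where
  open Graph G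

  edgeMap : (V → FinSet) → Edge → FinSet
  edgeMap f e = f (end₁ e) ⊕ f (end₂ e)

  record IsIASI (f : V → FinSet) : Set where
    field
      injective     : Injective _≡_ _≈_ f
      edgeInjective : Injective _≡_ _≈_ (edgeMap f)

  record IsWIASI (f : V → FinSet) : Set where
    field
      isIASI : IsIASI f
      weak   : ∀ e → ∣ edgeMap f e ∣ ≡ ∣ f (end₁ e) ∣ ⊔ ∣ f (end₂ e) ∣

  record IsUniformWIASI (k : ℕ) (f : V → FinSet) : Set where
    field
      isWIASI : IsWIASI f
      uniform : ∀ e → ∣ edgeMap f e ∣ ≡ k

  AdmitsUWIASI : Set
  AdmitsUWIASI = ∃ λ k → 2 ≤ k × ∃ λ f → IsUniformWIASI k f

{-# OPTIONS --safe #-}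
-- A super subdivision is bipartite, and every bipartite graph has a 2-uniform
-- WIASI. Number the n vertices by ι v < n; give v the set {ι v} on one side and
-- {n ι v , n ι v + 1} on the other. An edge joining u and x then receives
-- {a , a + 1} with a = n ι x + ι u, whose base-n digits recover u and x.
module Submission where

open import Defs
open import Data.Bool.Base using (Bool; true; false; if_then_else_)
open import Data.Empty using (⊥-elim; ⊥-elim-irr)
open import Data.Fin.Base using (toℕ; combine)
open import Data.Fin.Properties as Fin
  using (toℕ-injective; toℕ-combine; combine-injective; nonZeroIndex)
open import Data.Irrelevant using ([_])
open import Data.List.Base as List using (length)
open import Data.List.NonEmpty as List⁺ using (_∷_)
open import Data.List.Properties using (filter-accept)
open import Data.List.Relation.Unary.Any using (here; there)
open import Data.Nat.Base using (ℕ; suc; _+_; _*_; _⊔_; z<s; NonZero)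
open import Data.Nat.Properties as ℕ
  using (≤-refl; +-comm; *-cancelˡ-≡; 1+n≢n; <⇒≢; m<n+m; suc-injective)
open import Data.Product.Base using (∃₂; _×_; _,_; proj₁; proj₂)
open import Data.Refinement using (value; value-injective; _,_)
open import Data.Sum.Base using (_⊎_; inj₁; inj₂)
open import Function.Base using (_∘_)
open import Function.Bundles using (module Equivalence)
open import Function.Construct.Symmetry using (⇔-sym)
open import Function.Definitions using (Injective)
open import Relation.Binary.PropositionalEquality
  using (_≡_; _≢_; refl; sym; trans; cong; cong₂; subst₂; ≢-sym)
open import Relation.Nullary.Decidable using (¬?)
open import Relation.Nullary.Negation using (¬_; contradiction)

pair : ℕ → FinSet
pair a = a ∷ suc a List.∷ List.[]

∣pair∣≡2 : ∀ a → ∣ pair a ∣ ≡ 2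
∣pair∣≡2 a = cong (suc ∘ length)
  -- Deduplication keeps the head `a` and filters its copies out of the tail, where `suc a`
  -- survives.
  (filter-accept (λ b → ¬? (a ℕ.≟ b)) {xs = List.[]} (≢-sym 1+n≢n))

singleton-injective : Injective _≡_ _≈_ List⁺.[_]
singleton-injective {a} {b} A≈B with Equivalence.to A≈B (here refl)
... | here a≡b = a≡b

pair≉singleton : ∀ {a b} → ¬ (pair a ≈ List⁺.[ b ])
pair≉singleton {a} {b} A≈B
  with Equivalence.to A≈B (here refl) | Equivalence.to A≈B (there (here refl))
... | here a≡b | here 1+a≡b = 1+n≢n (trans 1+a≡b (sym a≡b))

pair-injective : Injective _≡_ _≈_ pair
pair-injective {a} {b} A≈B
  with Equivalence.to A≈B (here refl) | Equivalence.to A≈B (there (here refl))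
... | here a≡b            | _                     = a≡b
-- The crossed matching `a = 1 + b`, `1 + a = b` would give `b = 2 + b`.
... | there (here a≡1+b)  | here 1+a≡b            =
  contradiction (trans (sym 1+a≡b) (cong suc a≡1+b)) (<⇒≢ (m<n+m b z<s))
... | there (here _)      | there (here 1+a≡1+b)  = suc-injective 1+a≡1+b

[]⊕pair : ∀ a b → List⁺.[ a ] ⊕ pair b ≡ pair (b + a)
[]⊕pair a b = cong₂ (λ c d → c ∷ d List.∷ List.[]) (+-comm a b) (+-comm a (suc b))

module _ (G : Graph) where
  open Graph G

  -- An edge stores its ends in index order, which is unrelated to the colours; this forgets the
  -- order so that the ends can be named by colour.
  Joins : Edge → V → V → Set
  Joins e u v = value e ≡ (u , v) ⊎ value e ≡ (v , u)

  -- Edges listing the same two ends in opposite orders would need both `index u < index v` and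
  -- `index v < index u`.
  Joins-unique : ∀ {e e′ u v} → Joins e u v → Joins e′ u v → e ≡ e′
  Joins-unique (inj₁ p) (inj₁ q) = value-injective (trans p (sym q))
  Joins-unique (inj₂ p) (inj₂ q) = value-injective (trans p (sym q))
  Joins-unique {_ , [ r ]} {_ , [ s ]} (inj₁ refl) (inj₂ refl) =
    ⊥-elim-irr (Fin.<-asym (proj₁ r) (proj₁ s))
  Joins-unique {_ , [ r ]} {_ , [ s ]} (inj₂ refl) (inj₁ refl) =
    ⊥-elim-irr (Fin.<-asym (proj₁ r) (proj₁ s))

  module _ (colour : V → Bool) (proper : ∀ {u v} → u ~ v → colour u ≢ colour v) where

    private
      n : ℕ
      n = proj₁ finite

      ι : V → ℕ
      ι = toℕ ∘ index

      ι-injective : Injective _≡_ _≡_ ι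
      ι-injective = index-injective ∘ toℕ-injective

      label : V → FinSet
      label v = if colour v then pair (n * ι v) else List⁺.[ ι v ]

      label-injective : Injective _≡_ _≈_ label
      label-injective {u} {v} A≈B with colour u | colour v
      ... | true  | true  = ι-injective
        -- The factor `n` can be cancelled: it is nonzero because `index u` inhabits `Fin n`.
        (*-cancelˡ-≡ (ι u) (ι v) n {{nonZeroIndex (index u)}} (pair-injective A≈B))
      ... | true  | false = ⊥-elim (pair≉singleton A≈B)
      ... | false | true  = ⊥-elim (pair≉singleton (⇔-sym A≈B))
      ... | false | false = ι-injective (singleton-injective A≈B)

      -- The number `n * ι x + ι u`, built with `combine` so that recovering its base-`n` digits is
      -- the injectivity of `combine`.
      code : V → V → ℕ
      code x u = toℕ (combine (index x) (index u))

      code-injective : ∀ {x u y v} → code x u ≡ code y v → x ≡ y × u ≡ v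
      code-injective {x} {u} {y} {v} eq
        with p , q ← combine-injective (index x) (index u) (index y) (index v) (toℕ-injective eq)
        = index-injective p , index-injective q

      ends-differ : ∀ e → colour (end₁ e) ≢ colour (end₂ e)
      ends-differ (_ , [ p ]) eq = ⊥-elim-irr (proper (proj₂ p) eq)

      -- Here `u` is the end with a singleton and `x` the end with a pair. Both the size and the
      -- injectivity of edge labels are read off from this form.
      edge-label : ∀ e → ∃₂ λ u x → Joins e u x × edgeMap G label e ≡ pair (code x u)
      edge-label e with colour (end₁ e) | colour (end₂ e) | ends-differ e
      ... | true  | true  | t≢t = contradiction refl t≢t
      ... | false | false | f≢f = contradiction refl f≢f
      ... | false | true  | _   = end₁ e , end₂ e , inj₁ refl ,
        trans ([]⊕pair _ _) (cong pair (sym (toℕ-combine (index (end₂ e)) (index (end₁ e)))))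
      -- With the pair on the left the sum computes to a pair; the opposite order above needs
      -- commutativity, through `[]⊕pair`.
      ... | true  | false | _   = end₂ e , end₁ e , inj₂ refl ,
        cong pair (sym (toℕ-combine (index (end₁ e)) (index (end₂ e))))

      edge-label-injective : Injective _≡_ _≈_ (edgeMap G label)
      edge-label-injective {e} {e′} A≈B
        with u , x , j , p ← edge-label e | v , y , j′ , q ← edge-label e′
        -- Equal codes identify the singleton ends of the two edges and likewise their pair ends.
        with refl , refl ← code-injective {x} {u} {y} {v} (pair-injective (subst₂ _≈_ p q A≈B))
        = Joins-unique j j′

      ∣edge-label∣≡2 : ∀ e → ∣ edgeMap G label e ∣ ≡ 2
      ∣edge-label∣≡2 e with u , x , _ , p ← edge-label e = trans (cong ∣_∣ p) (∣pair∣≡2 (code x u))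

      ∣ends∣≡2 : ∀ e → ∣ label (end₁ e) ∣ ⊔ ∣ label (end₂ e) ∣ ≡ 2
      ∣ends∣≡2 e with colour (end₁ e) | colour (end₂ e) | ends-differ e
      ... | true  | true  | t≢t = contradiction refl t≢t
      ... | false | false | f≢f = contradiction refl f≢f
      ... | false | true  | _   = cong (1 ⊔_) (∣pair∣≡2 (n * ι (end₂ e)))
      ... | true  | false | _   = cong (_⊔ 1) (∣pair∣≡2 (n * ι (end₁ e)))

    bipartite⇒AdmitsUWIASI : AdmitsUWIASI G
    bipartite⇒AdmitsUWIASI = 2 , ≤-refl , label , record
      { isWIASI = record
        { isIASI = record
          { injective     = label-injective
          ; edgeInjective = edge-label-injective
          }
        ; weak = λ e → trans (∣edge-label∣≡2 e) (sym (∣ends∣≡2 e))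
        }
      ; uniform = ∣edge-label∣≡2
      }

-- The bipartition: original vertices will carry singletons and new ones pairs.
isNew : ∀ {G m} → SubdivisionVertex G m → Bool
isNew (inj₁ _) = false
isNew (inj₂ _) = true

isNew-proper : ∀ {G m} {a b : SubdivisionVertex G m} →
               SubdivisionAdjacent G m a b → isNew {G} {m} a ≢ isNew {G} {m} b
isNew-proper {a = inj₁ _} {inj₂ _} _ ()
isNew-proper {a = inj₂ _} {inj₁ _} _ ()

mainTheorem16 : (G : Graph) (m : ℕ) .{{_ : NonZero m}} → AdmitsUWIASI (superSubdivision G m)
mainTheorem16 G m = bipartite⇒AdmitsUWIASI (superSubdivision G m) (isNew {G} {m})
  λ {a} {b} → isNew-proper {G} {m} {a} {b}
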